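{- For all $P,Q\in C_A$, $P=_{cse}Q$ if and only if $P=_{cbf}Q$; that is, $cse(P)=cse(Q)$ if and only if $cbf(P)=cbf(Q)$.
   Context: Let $A$ be a countable set (of atoms) with at least two elements. $C_A$ is the set of closed terms (conditional statements) over the signature with constants $T$, $F$, a constant $a$ for each $a\in A$, and one ternary operation $x\triangleleft y\triangleright z$ (the conditional, "if $y$ then $x$ else $z$"). Evaluation trees: the set $\mathcal T_A$ is defined inductively by $T\in\mathcal T_A$, $F\in\mathcal T_A$, and $(X\trianglelefteq a\trianglerighteq Y)\in\mathcal T_A$ for all $X,Y\in\mathcal T_A$, $a\in A$ (binary tree with root $a$, left branch $X$, right branch $Y$). Leaf replacement: for $Y,Z\in\mathcal T_A$, $X[T\mapsto Y,F\mapsto Z]$ is defined by $T[T\mapsto Y,F\mapsto Z]=Y$, $F[T\mapsto Y,F\mapsto Z]=Z$, $(X_1\trianglelefteq a\trianglerighteq X_2)[T\mapsto Y,F\mapsto Z]=X_1[T\mapsto Y,F\mapsto Z]\trianglelefteq a\trianglerighteq X_2[T\mapsto Y,F\mapsto Z]$. The short-circuit evaluation function $se:C_A\to\mathcal T_A$ is defined by $se(T)=T$, $se(F)=F$, $se(a)=T\trianglelefteq a\trianglerighteq F$ for $a\in A$, and $se(P\triangleleft Q\triangleright R)=se(Q)[T\mapsto se(P),F\mapsto se(R)]$. Contractive evaluation trees: for $a\in A$ define $H_a,J_a:\mathcal T_A\to\mathcal T_A$ by $H_a(B)=J_a(B)=B$ for $B\in\{T,F\}$; $H_a(X\trianglelefteq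 a\trianglerighteq Y)=H_a(X)$; $J_a(X\trianglelefteq a\trianglerighteq Y)=J_a(Y)$; and $H_a(X\trianglelefteq b\trianglerighteq Y)=J_a(X\trianglelefteq b\trianglerighteq Y)=X\trianglelefteq b\trianglerighteq Y$ if $b\neq a$. Define $cr:\mathcal T_A\to\mathcal T_A$ (by recursion on depth) by $cr(T)=T$, $cr(F)=F$, $cr(X\trianglelefteq a\trianglerighteq Y)=cr(H_a(X))\trianglelefteq a\trianglerighteq cr(J_a(Y))$. Then $cse:C_A\to\mathcal T_A$ is $cse(P)=cr(se(P))$, and $P=_{cse}Q$ iff $cse(P)=cse(Q)$. Basic forms: $BF_A\subseteq C_A$ is given by the grammar $t::=T\mid F\mid t\triangleleft a\triangleright t$ ($a\in A$). For $P,Q,R\in BF_A$, $P[T\mapsto Q,F\mapsto R]\in BF_A$ is obtained by replacing all occurrences of $T$ in $P$ by $Q$ and all occurrences of $F$ in $P$ by $R$ (simultaneously). The basic form function $bf:C_A\to BF_A$ is defined by $bf(T)=T$, $bf(F)=F$, $bf(a)=T\triangleleft a\triangleright F$ for $a\in A$, $bf(P\triangleleft Q\triangleright R)=bf(Q)[T\mapsto bf(P),F\mapsto bf(R)]$. The function $cbf$: for $a\in A$ define $h_a,j_a:BF_A\to BF_A$ by $h_a(B)=j_a(B)=B$ for $B\in\{T,F\}$; $h_a(P\triangleleft a\triangleright Q)=h_a(P)$; $j_a(P\triangleleft a\triangleright Q)=j_a(Q)$; and $h_a(P\triangleleft b\triangleright Q)=j_a(P\triangleleft b\triangleright Q)=P\triangleleft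 b\triangleright Q$ if $b\neq a$. Define $cf:BF_A\to BF_A$ (by recursion on depth) by $cf(T)=T$, $cf(F)=F$, $cf(P\triangleleft a\triangleright Q)=cf(h_a(P))\triangleleft a\triangleright cf(j_a(Q))$. Then $cbf(P)=cf(bf(P))$ for $P\in C_A$, and $P=_{cbf}Q$ iff $cbf(P)=cbf(Q)$ (syntactic equality). -}

module Defs where

open import Level using (Level)
open import Data.Bool.Base using (if_then_else_)
open import Data.Nat.Base using (ℕ; suc; _≤_; _<_; _⊔_; s≤s)
open import Data.Nat.Induction using (<-wellFounded)
import Data.Nat.Properties as ℕ
open import Data.Product.Base using (Σ; _,_; proj₁)
open import Function.Bundles using (_↣_)
open import Induction.WellFounded using (Acc; acc)
open import Relation.Binary.Definitions using (DecidableEquality)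
open import Relation.Binary.PropositionalEquality using (_≡_; refl; cong₂)
open import Relation.Nullary.Decidable using (yes; no; does; via-injection)

private
  variable
    ℓ : Level
    A : Set ℓ

-- Countable, finite or infinite, is read as having an injection into ℕ; this makes
-- equality of atoms decidable, which the case distinction b = a below requires.
countable⇒≟ : A ↣ ℕ → DecidableEquality A
countable⇒≟ A↣ℕ = via-injection A↣ℕ ℕ._≟_

infix 6 _◁_▷_ _⊴_⊵_

-- Closed terms; x ◁ y ▷ z is "if y then x else z".
data C (A : Set ℓ) : Set ℓ where
  T F   : C A
  atom  : A → C A
  _◁_▷_ : C A → C A → C A → C A

data 𝒯 (A : Set ℓ) : Set ℓ where
  T F   : 𝒯 A
  _⊴_⊵_ : 𝒯 A → A → 𝒯 A → 𝒯 A

_[T↦_,F↦_] : 𝒯 A → 𝒯 A → 𝒯 A → 𝒯 A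
T           [T↦ Y ,F↦ Z ] = Y
F           [T↦ Y ,F↦ Z ] = Z
(X ⊴ a ⊵ W) [T↦ Y ,F↦ Z ] = (X [T↦ Y ,F↦ Z ]) ⊴ a ⊵ (W [T↦ Y ,F↦ Z ])

se : C A → 𝒯 A
se T           = T
se F           = F
se (atom a)    = T ⊴ a ⊵ F
se (P ◁ Q ▷ R) = se Q [T↦ se P ,F↦ se R ]

data IsBF {A : Set ℓ} : C A → Set ℓ where
  T     : IsBF T
  F     : IsBF F
  _◁_▷_ : ∀ {P Q} → IsBF P → (a : A) → IsBF Q → IsBF (P ◁ atom a ▷ Q)

isBF-irrelevant : {P : C A} (p q : IsBF P) → p ≡ q
isBF-irrelevant T           T             = refl
isBF-irrelevant F           F             = refl
isBF-irrelevant (p ◁ a ▷ q) (p′ ◁ .a ▷ q′) =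
  cong₂ (_◁ a ▷_) (isBF-irrelevant p p′) (isBF-irrelevant q q′)

-- A subset of the closed terms, by isBF-irrelevant.
BF : Set ℓ → Set ℓ
BF A = Σ (C A) IsBF

-- Replaces every occurrence of T and F in an arbitrary closed term; basic forms are
-- closed under it.
_[T:=_,F:=_] : C A → C A → C A → C A
T           [T:= Q ,F:= R ] = Q
F           [T:= Q ,F:= R ] = R
atom a      [T:= Q ,F:= R ] = atom a
(P ◁ S ▷ U) [T:= Q ,F:= R ] =
  (P [T:= Q ,F:= R ]) ◁ (S [T:= Q ,F:= R ]) ▷ (U [T:= Q ,F:= R ])

replace-isBF : {P Q R : C A} → IsBF P → IsBF Q → IsBF R → IsBF (P [T:= Q ,F:= R ])
replace-isBF T           q r = q
replace-isBF F           q r = r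
replace-isBF (p ◁ a ▷ s) q r = replace-isBF p q r ◁ a ▷ replace-isBF s q r

_[T↦_,F↦_]ᴮ : BF A → BF A → BF A → BF A
(P , p) [T↦ (Q , q) ,F↦ (R , r) ]ᴮ = (P [T:= Q ,F:= R ]) , replace-isBF p q r

bf : C A → BF A
bf T           = T , T
bf F           = F , F
bf (atom a)    = (T ◁ atom a ▷ F) , (T ◁ a ▷ F)
bf (P ◁ Q ▷ R) = bf Q [T↦ bf P ,F↦ bf R ]ᴮ

depth : 𝒯 A → ℕ
depth T           = 0
depth F           = 0
depth (X ⊴ a ⊵ Y) = suc (depth X ⊔ depth Y)

depthᴮ : BF A → ℕ
depthᴮ (_ , T)         = 0
depthᴮ (_ , F)         = 0
depthᴮ (_ , p ◁ a ▷ q) = suc (depthᴮ (_ , p) ⊔ depthᴮ (_ , q))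

node : BF A → A → BF A → BF A
node (P , p) a (Q , q) = (P ◁ atom a ▷ Q) , (p ◁ a ▷ q)

module Contraction {A : Set ℓ} (_≟_ : DecidableEquality A) where

  H : A → 𝒯 A → 𝒯 A
  H a T = T
  H a F = F
  H a (X ⊴ b ⊵ Y) = if does (b ≟ a) then H a X else X ⊴ b ⊵ Y

  J : A → 𝒯 A → 𝒯 A
  J a T = T
  J a F = F
  J a (X ⊴ b ⊵ Y) = if does (b ≟ a) then J a Y else X ⊴ b ⊵ Y

  depth-H : ∀ a X → depth (H a X) ≤ depth X
  depth-H a T = ℕ.≤-refl
  depth-H a F = ℕ.≤-refl
  depth-H a (X ⊴ b ⊵ Y) with b ≟ a
  ... | yes _ = ℕ.m≤n⇒m≤1+n (ℕ.≤-trans (depth-H a X) (ℕ.m≤m⊔n _ _))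
  ... | no  _ = ℕ.≤-refl

  depth-J : ∀ a X → depth (J a X) ≤ depth X
  depth-J a T = ℕ.≤-refl
  depth-J a F = ℕ.≤-refl
  depth-J a (X ⊴ b ⊵ Y) with b ≟ a
  ... | yes _ = ℕ.m≤n⇒m≤1+n (ℕ.≤-trans (depth-J a Y) (ℕ.m≤n⊔m (depth X) _))
  ... | no  _ = ℕ.≤-refl

  depth-H< : ∀ X a Y → depth (H a X) < depth (X ⊴ a ⊵ Y)
  depth-H< X a Y = s≤s (ℕ.≤-trans (depth-H a X) (ℕ.m≤m⊔n _ _))

  depth-J< : ∀ X a Y → depth (J a Y) < depth (X ⊴ a ⊵ Y)
  depth-J< X a Y = s≤s (ℕ.≤-trans (depth-J a Y) (ℕ.m≤n⊔m (depth X) _))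

  crAcc : ∀ X → Acc _<_ (depth X) → 𝒯 A
  crAcc T           _        = T
  crAcc F           _        = F
  crAcc (X ⊴ a ⊵ Y) (acc rs) =
    crAcc (H a X) (rs (depth-H< X a Y)) ⊴ a ⊵ crAcc (J a Y) (rs (depth-J< X a Y))

  cr : 𝒯 A → 𝒯 A
  cr X = crAcc X (<-wellFounded (depth X))

  crAcc-irrelevant : ∀ X (p q : Acc _<_ (depth X)) → crAcc X p ≡ crAcc X q
  crAcc-irrelevant T           _        _        = refl
  crAcc-irrelevant F           _        _        = refl
  crAcc-irrelevant (X ⊴ a ⊵ Y) (acc rs) (acc ss) =
    cong₂ (_⊴ a ⊵_) (crAcc-irrelevant (H a X) _ _) (crAcc-irrelevant (J a Y) _ _)

  -- cr satisfies its recursive definition (its clauses for T and F hold by refl).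
  cr-node : ∀ X a Y → cr (X ⊴ a ⊵ Y) ≡ cr (H a X) ⊴ a ⊵ cr (J a Y)
  cr-node X a Y = cong₂ (_⊴ a ⊵_)
    (crAcc-irrelevant (H a X) _ _) (crAcc-irrelevant (J a Y) _ _)

  cse : C A → 𝒯 A
  cse P = cr (se P)

  h : A → BF A → BF A
  h a (_ , T) = T , T
  h a (_ , F) = F , F
  h a (_ , p ◁ b ▷ q) = if does (b ≟ a) then h a (_ , p) else (_ , p ◁ b ▷ q)

  j : A → BF A → BF A
  j a (_ , T) = T , T
  j a (_ , F) = F , F
  j a (_ , p ◁ b ▷ q) = if does (b ≟ a) then j a (_ , q) else (_ , p ◁ b ▷ q)

  depth-h : ∀ a P → depthᴮ (h a P) ≤ depthᴮ P
  depth-h a (_ , T) = ℕ.≤-refl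
  depth-h a (_ , F) = ℕ.≤-refl
  depth-h a (_ , p ◁ b ▷ q) with b ≟ a | depth-h a (_ , p)
  ... | yes _ | ih = ℕ.m≤n⇒m≤1+n (ℕ.≤-trans ih (ℕ.m≤m⊔n _ _))
  ... | no  _ | _  = ℕ.≤-refl

  depth-j : ∀ a P → depthᴮ (j a P) ≤ depthᴮ P
  depth-j a (_ , T) = ℕ.≤-refl
  depth-j a (_ , F) = ℕ.≤-refl
  depth-j a (_ , p ◁ b ▷ q) with b ≟ a | depth-j a (_ , q)
  ... | yes _ | ih = ℕ.m≤n⇒m≤1+n (ℕ.≤-trans ih (ℕ.m≤n⊔m (depthᴮ (_ , p)) _))
  ... | no  _ | _  = ℕ.≤-refl

  depth-h< : ∀ P a Q → depthᴮ (h a P) < depthᴮ (node P a Q)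
  depth-h< P a Q = s≤s (ℕ.≤-trans (depth-h a P) (ℕ.m≤m⊔n _ _))

  depth-j< : ∀ P a Q → depthᴮ (j a Q) < depthᴮ (node P a Q)
  depth-j< P a Q = s≤s (ℕ.≤-trans (depth-j a Q) (ℕ.m≤n⊔m (depthᴮ P) _))

  cfAcc : ∀ P → Acc _<_ (depthᴮ P) → BF A
  cfAcc (_ , T)         _        = T , T
  cfAcc (_ , F)         _        = F , F
  cfAcc (_ , p ◁ a ▷ q) (acc rs) =
    node (cfAcc (h a (_ , p)) (rs (depth-h< (_ , p) a (_ , q))))
         a
         (cfAcc (j a (_ , q)) (rs (depth-j< (_ , p) a (_ , q))))

  cf : BF A → BF A
  cf P = cfAcc P (<-wellFounded (depthᴮ P))

  cfAcc-irrelevant : ∀ P (p q : Acc _<_ (depthᴮ P)) → cfAcc P p ≡ cfAcc P q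
  cfAcc-irrelevant (_ , T)         _        _        = refl
  cfAcc-irrelevant (_ , F)         _        _        = refl
  cfAcc-irrelevant (_ , p ◁ a ▷ q) (acc rs) (acc ss) =
    cong₂ (λ P Q → node P a Q) (cfAcc-irrelevant (h a (_ , p)) _ _)
                               (cfAcc-irrelevant (j a (_ , q)) _ _)

  -- cf satisfies its recursive definition (its clauses for T and F hold by refl).
  cf-node : ∀ P a Q → cf (node P a Q) ≡ node (cf (h a P)) a (cf (j a Q))
  cf-node P a Q = cong₂ (λ P′ Q′ → node P′ a Q′)
    (cfAcc-irrelevant (h a P) _ _) (cfAcc-irrelevant (j a Q) _ _)

  cbf : C A → BF A
  cbf P = cf (bf P)

  infix 4 _=cse_ _=cbf_

  _=cse_ : C A → C A → Set ℓ
  P =cse Q = cse P ≡ cse Q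

  -- Syntactic equality, of the underlying closed terms.
  _=cbf_ : C A → C A → Set ℓ
  P =cbf Q = proj₁ (cbf P) ≡ proj₁ (cbf Q)

{-# OPTIONS --safe #-}
-- A basic form P ◁ a ▷ Q has short-circuit evaluation se P ⊴ a ⊵ se Q, so se restricts
-- to an injection of basic forms into evaluation trees. It carries bf P to se P and
-- commutes with contraction, hence sends cbf P to cse P.
module Submission where

open import Level using (Level)
open import Data.Nat.Base using (ℕ; _<_)
open import Data.Nat.Induction using (<-wellFounded)
open import Data.Product.Base using (∃-syntax; _,_; proj₁; proj₂)
open import Function.Bundles using (_↣_; _⇔_; mk⇔)
open import Induction.WellFounded using (Acc; acc)
open import Relation.Binary.Definitions using (DecidableEquality)
open import Relation.Binary.PropositionalEquality
  using (_≡_; _≢_; refl; sym; trans; cong; cong₂; module ≡-Reasoning)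
open import Relation.Nullary.Decidable using (yes; no)
open import Defs

private
  variable
    ℓ : Level
    B : Set ℓ

⊴⊵-injectiveˡ : ∀ {X Y X′ Y′ : 𝒯 B} {a b} → X ⊴ a ⊵ Y ≡ X′ ⊴ b ⊵ Y′ → X ≡ X′
⊴⊵-injectiveˡ refl = refl

⊴⊵-injectiveᵐ : ∀ {X Y X′ Y′ : 𝒯 B} {a b} → X ⊴ a ⊵ Y ≡ X′ ⊴ b ⊵ Y′ → a ≡ b
⊴⊵-injectiveᵐ refl = refl

⊴⊵-injectiveʳ : ∀ {X Y X′ Y′ : 𝒯 B} {a b} → X ⊴ a ⊵ Y ≡ X′ ⊴ b ⊵ Y′ → Y ≡ Y′
⊴⊵-injectiveʳ refl = refl

-- On basic forms the root and the two subtrees of the tree determine the atom and the two branches.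
-- Outside them this fails: `atom a` and `T ◁ atom a ▷ F` share a tree.
se-injective : {P Q : C B} → IsBF P → IsBF Q → se P ≡ se Q → P ≡ Q
se-injective T           T             _  = refl
se-injective F           F             _  = refl
se-injective (p ◁ a ▷ q) (p′ ◁ b ▷ q′) eq
  with refl ← ⊴⊵-injectiveᵐ eq =
  cong₂ (_◁ atom a ▷_) (se-injective p p′ (⊴⊵-injectiveˡ eq))
                       (se-injective q q′ (⊴⊵-injectiveʳ eq))

-- The condition of a basic form is an atom, which replacement leaves fixed, so the occurrences of
-- `T` and `F` replaced in `P` are exactly the leaves of its tree.
se-replace : {P : C B} → IsBF P → ∀ Q R →
  se (P [T:= Q ,F:= R ]) ≡ se P [T↦ se Q ,F↦ se R ]
se-replace T           Q R = refl
se-replace F           Q R = refl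
se-replace (p ◁ a ▷ q) Q R = cong₂ (_⊴ a ⊵_) (se-replace p Q R) (se-replace q Q R)

[T↦,F↦]-cong : ∀ {X X′ Y Y′ Z Z′ : 𝒯 B} → X ≡ X′ → Y ≡ Y′ → Z ≡ Z′ →
  X [T↦ Y ,F↦ Z ] ≡ X′ [T↦ Y′ ,F↦ Z′ ]
[T↦,F↦]-cong refl refl refl = refl

se-bf : (P : C B) → se (proj₁ (bf P)) ≡ se P
se-bf T           = refl
se-bf F           = refl
se-bf (atom a)    = refl
se-bf (P ◁ Q ▷ R) = trans
  (se-replace (proj₂ (bf Q)) (proj₁ (bf P)) (proj₁ (bf R)))
  ([T↦,F↦]-cong (se-bf Q) (se-bf P) (se-bf R))

module _ {ℓ} {A : Set ℓ} (_≟_ : DecidableEquality A) where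
  open Contraction _≟_

  -- Both sides branch on the same test `b ≟ a`, and `se` sends the left branch of a node to its
  -- left subtree.
  se-h : ∀ a P → se (proj₁ (h a P)) ≡ H a (se (proj₁ P))
  se-h a (_ , T)         = refl
  se-h a (_ , F)         = refl
  se-h a (_ , p ◁ b ▷ q) with b ≟ a | se-h a (_ , p)
  ... | yes _ | ih = ih
  ... | no  _ | _  = refl

  se-j : ∀ a P → se (proj₁ (j a P)) ≡ J a (se (proj₁ P))
  se-j a (_ , T)         = refl
  se-j a (_ , F)         = refl
  se-j a (_ , p ◁ b ▷ q) with b ≟ a | se-j a (_ , q)
  ... | yes _ | ih = ih
  ... | no  _ | _  = refl

  -- `h a P` and `j a Q` are not syntactic subterms of the node, so the induction is on depth. Its
  -- accessibility proof is separate from those inside `cf` and `cr`, which `cf-node` and `cr-node`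
  -- absorb.
  se-cf-acc : ∀ P → Acc _<_ (depthᴮ P) → se (proj₁ (cf P)) ≡ cr (se (proj₁ P))
  se-cf-acc (_ , T) _ = refl
  se-cf-acc (_ , F) _ = refl
  se-cf-acc (_ , _◁_▷_ {P₀} {Q₀} p a q) (acc rs) = begin
    se (proj₁ (cf (node P a Q)))
      ≡⟨ cong (λ R → se (proj₁ R)) (cf-node P a Q) ⟩
    se (proj₁ (cf (h a P))) ⊴ a ⊵ se (proj₁ (cf (j a Q)))
      ≡⟨ cong₂ (_⊴ a ⊵_) (se-cf-acc (h a P) (rs (depth-h< P a Q)))
                         (se-cf-acc (j a Q) (rs (depth-j< P a Q))) ⟩
    cr (se (proj₁ (h a P))) ⊴ a ⊵ cr (se (proj₁ (j a Q)))
      ≡⟨ cong₂ (λ X Y → cr X ⊴ a ⊵ cr Y) (se-h a P) (se-j a Q) ⟩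
    cr (H a (se P₀)) ⊴ a ⊵ cr (J a (se Q₀))
      ≡⟨ cr-node (se P₀) a (se Q₀) ⟨
    cr (se P₀ ⊴ a ⊵ se Q₀) ∎
    where
    open ≡-Reasoning
    P Q : BF A
    P = P₀ , p
    Q = Q₀ , q

  se-cf : ∀ P → se (proj₁ (cf P)) ≡ cr (se (proj₁ P))
  se-cf P = se-cf-acc P (<-wellFounded (depthᴮ P))

  se-cbf : ∀ P → se (proj₁ (cbf P)) ≡ cse P
  se-cbf P = trans (se-cf (bf P)) (cong cr (se-bf P))

  =cse⇔=cbf : ∀ P Q → (P =cse Q) ⇔ (P =cbf Q)
  =cse⇔=cbf P Q = mk⇔
    -- Injectivity applies because contraction returns basic forms.
    (λ eq → se-injective (proj₂ (cbf P)) (proj₂ (cbf Q))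
              (trans (se-cbf P) (trans eq (sym (se-cbf Q)))))
    (λ eq → trans (sym (se-cbf P)) (trans (cong se eq) (se-cbf Q)))

proposition4p14 : ∀ {ℓ} (A : Set ℓ) (countable : A ↣ ℕ) (twoElements : ∃[ x ] ∃[ y ] (_≢_ {A = A} x y)) →
    let open Contraction (countable⇒≟ countable) in
    (P Q : C A) → (P =cse Q) ⇔ (P =cbf Q)
proposition4p14 A countable _ = =cse⇔=cbf (countable⇒≟ countable)
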